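{- Let $\langle\mathbb A,\sigma\restriction\mathbb A\rangle$ and $\langle\mathbb B,\sigma\restriction\mathbb B\rangle$ be elementary substructures of $\langle\mathcal P(\omega)/\mathrm{Fin},\sigma\rangle$, and let $\langle\mathbb C,\sigma^{ -1}\restriction\mathbb C\rangle$ be an elementary substructure of $\langle\mathcal P(\omega)/\mathrm{Fin},\sigma^{ -1}\rangle$. Then: (i) every embedding of $\langle\mathbb A,\sigma\restriction\mathbb A\rangle$ into $\langle\mathbb B,\sigma\restriction\mathbb B\rangle$ is an elementary embedding; (ii) every embedding of $\langle\mathbb A,\sigma\restriction\mathbb A\rangle$ into $\langle\mathcal P(\omega)/\mathrm{Fin},\sigma^{ -1}\rangle$ is an elementary embedding; (iii) every embedding of $\langle\mathbb C,\sigma^{ -1}\restriction\mathbb C\rangle$ into $\langle\mathcal P(\omega)/\mathrm{Fin},\sigma\rangle$ is an elementary embedding.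
   Context: $\mathcal P(\omega)/\mathrm{Fin}$ is $\mathcal P(\omega)$ modulo finite sets, $\sigma([A])=[A+1]$. An embedding of dynamical systems $\langle\mathbb A,\alpha\rangle\to\langle\mathbb B,\beta\rangle$ is an injective Boolean homomorphism $\eta$ with $\eta\circ\alpha=\beta\circ\eta$; it is elementary if it preserves the truth value of all first-order formulas with parameters, in the language with constants $\mathbf 0,\mathbf 1$, Boolean operations, $\le$, and unary function symbols for the automorphism and its inverse. An elementary substructure is a subalgebra closed under the automorphism and its inverse whose inclusion is an elementary embedding. No hypothesis beyond ZFC. -}

module Defs where

open import Data.Nat using (ℕ; zero; suc; _≤_)
open import Data.Bool using (Bool; true; false; _∧_; _∨_; not)
open import Data.Fin using (Fin)
open import Data.Product using (Σ; _×_; _,_; proj₁; proj₂)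
open import Data.Sum using (_⊎_)
open import Data.Unit using (⊤)
open import Data.Empty using (⊥)
open import Relation.Binary.PropositionalEquality using (_≡_)
open import Function.Bundles using (_⇔_)

-- P(ω): subsets of ω as characteristic functions ℕ → Bool.
-- P(ω)/Fin is represented as the setoid (ℕ → Bool , _≈*_) where
-- _≈*_ is equality modulo a finite set.

Pω : Set
Pω = ℕ → Bool

_≈*_ : Pω → Pω → Set
a ≈* b = Σ ℕ λ N → ∀ n → N ≤ n → a n ≡ b n

_≤*_ : Pω → Pω → Set
a ≤* b = Σ ℕ λ N → ∀ n → N ≤ n → a n ≡ true → b n ≡ true

𝟎 𝟏 : Pω
𝟎 _ = false
𝟏 _ = true

_⊓_ _⊔_ : Pω → Pω → Pω
(a ⊓ b) n = a n ∧ b n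
(a ⊔ b) n = a n ∨ b n

∁ : Pω → Pω
∁ a n = not (a n)

-- σ([A]) = [A+1]  and its inverse σ⁻¹([A]) = [(A-1) ∩ ω]
σ : Pω → Pω
σ a zero    = false
σ a (suc n) = a n

σ⁻¹ : Pω → Pω
σ⁻¹ a n = a (suc n)

-- Which automorphism interprets the function symbol of the language:
-- fwd : ⟨P(ω)/Fin , σ⟩ ,   bwd : ⟨P(ω)/Fin , σ⁻¹⟩

data Dir : Set where
  fwd bwd : Dir

aut autInv : Dir → Pω → Pω
aut fwd = σ
aut bwd = σ⁻¹
autInv fwd = σ⁻¹
autInv bwd = σ

data Term (n : ℕ) : Set where
  var        : Fin n → Term n
  zeroT oneT : Term n
  _∧T_ _∨T_  : Term n → Term n → Term n
  compT      : Term n → Term n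
  fT finvT   : Term n → Term n

data Formula : ℕ → Set where
  _≐_ _≼_   : ∀ {n} → Term n → Term n → Formula n
  ⊤F ⊥F     : ∀ {n} → Formula n
  ¬F_       : ∀ {n} → Formula n → Formula n
  _∧F_ _∨F_ _⇒F_ : ∀ {n} → Formula n → Formula n → Formula n
  ∀F ∃F     : ∀ {n} → Formula (suc n) → Formula n

-- Structures: a subset D of representatives (a subalgebra of P(ω)/Fin
-- given by the representatives of its elements) with the automorphism
-- chosen by a Dir.

Elem : (Pω → Set) → Set
Elem D = Σ Pω D

Full : Pω → Set
Full _ = ⊤

extend : ∀ {n} {X : Set} → X → (Fin n → X) → Fin (suc n) → X
extend x ρ Fin.zero    = x
extend x ρ (Fin.suc i) = ρ i

evalT : ∀ {n} → Dir → (Fin n → Pω) → Term n → Pω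
evalT d ρ (var i)   = ρ i
evalT d ρ zeroT     = 𝟎
evalT d ρ oneT      = 𝟏
evalT d ρ (s ∧T t)  = evalT d ρ s ⊓ evalT d ρ t
evalT d ρ (s ∨T t)  = evalT d ρ s ⊔ evalT d ρ t
evalT d ρ (compT t) = ∁ (evalT d ρ t)
evalT d ρ (fT t)    = aut d (evalT d ρ t)
evalT d ρ (finvT t) = autInv d (evalT d ρ t)

Sat : (D : Pω → Set) → Dir → ∀ {n} → Formula n → (Fin n → Elem D) → Set
Sat D d (s ≐ t) ρ = evalT d (λ i → proj₁ (ρ i)) s ≈* evalT d (λ i → proj₁ (ρ i)) t
Sat D d (s ≼ t) ρ = evalT d (λ i → proj₁ (ρ i)) s ≤* evalT d (λ i → proj₁ (ρ i)) t
Sat D d ⊤F ρ = ⊤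
Sat D d ⊥F ρ = ⊥
Sat D d (¬F φ) ρ = Sat D d φ ρ → ⊥
Sat D d (φ ∧F ψ) ρ = Sat D d φ ρ × Sat D d ψ ρ
Sat D d (φ ∨F ψ) ρ = Sat D d φ ρ ⊎ Sat D d ψ ρ
Sat D d (φ ⇒F ψ) ρ = Sat D d φ ρ → Sat D d ψ ρ
Sat D d (∀F φ) ρ = (x : Elem D) → Sat D d φ (extend x ρ)
Sat D d (∃F φ) ρ = Σ (Elem D) λ x → Sat D d φ (extend x ρ)

record IsSubstructure (D : Pω → Set) : Set where
  field
    resp  : ∀ {a b} → a ≈* b → D a → D b
    has𝟎  : D 𝟎
    has𝟏  : D 𝟏
    clo⊓  : ∀ {a b} → D a → D b → D (a ⊓ b)
    clo⊔  : ∀ {a b} → D a → D b → D (a ⊔ b)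
    clo∁  : ∀ {a} → D a → D (∁ a)
    cloσ  : ∀ {a} → D a → D (σ a)
    cloσ⁻¹ : ∀ {a} → D a → D (σ⁻¹ a)

IsElementary : (D₁ : Pω → Set) (d₁ : Dir) (D₂ : Pω → Set) (d₂ : Dir)
               (η : Elem D₁ → Elem D₂) → Set
IsElementary D₁ d₁ D₂ d₂ η =
  ∀ {n} (φ : Formula n) (ρ : Fin n → Elem D₁) →
    Sat D₁ d₁ φ ρ ⇔ Sat D₂ d₂ φ (λ i → η (ρ i))

record IsElementarySubstructure (D : Pω → Set) (d : Dir) : Set₁ where
  field
    isSub      : IsSubstructure D
    elementary : IsElementary D d Full d (λ x → proj₁ x , _)

record IsEmbedding (D₁ : Pω → Set) (d₁ : Dir) (D₂ : Pω → Set) (d₂ : Dir)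
                   (η : Elem D₁ → Elem D₂) : Set where
  private
    ⟦_⟧ : Elem D₁ → Pω
    ⟦ x ⟧ = proj₁ (η x)
  field
    wellDefined : ∀ (x y : Elem D₁) → proj₁ x ≈* proj₁ y → ⟦ x ⟧ ≈* ⟦ y ⟧
    injective   : ∀ (x y : Elem D₁) → ⟦ x ⟧ ≈* ⟦ y ⟧ → proj₁ x ≈* proj₁ y
    pres𝟎 : ∀ (x : Elem D₁) → proj₁ x ≈* 𝟎 → ⟦ x ⟧ ≈* 𝟎
    pres𝟏 : ∀ (x : Elem D₁) → proj₁ x ≈* 𝟏 → ⟦ x ⟧ ≈* 𝟏
    pres⊓ : ∀ (x y z : Elem D₁) → proj₁ z ≈* (proj₁ x ⊓ proj₁ y) →
              ⟦ z ⟧ ≈* (⟦ x ⟧ ⊓ ⟦ y ⟧)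
    pres⊔ : ∀ (x y z : Elem D₁) → proj₁ z ≈* (proj₁ x ⊔ proj₁ y) →
              ⟦ z ⟧ ≈* (⟦ x ⟧ ⊔ ⟦ y ⟧)
    pres∁ : ∀ (x z : Elem D₁) → proj₁ z ≈* ∁ (proj₁ x) → ⟦ z ⟧ ≈* ∁ ⟦ x ⟧
    commute : ∀ (x z : Elem D₁) → proj₁ z ≈* aut d₁ (proj₁ x) →
              ⟦ z ⟧ ≈* aut d₂ ⟦ x ⟧

{-# OPTIONS --safe #-}

-- Quantifying over P(ω)/Fin can be eliminated by finite semigroups, as for Büchi automata.  For every
-- formula φ there are a finite semigroup S, a map from letters (the values of the parameters at a position)
-- to S and a subset P of S such that, whenever the word of letters can be cut, up to a finite part, into
-- blocks of value e for an idempotent e, φ holds exactly when e ∈ P.  By Ramsey's theorem every word admits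
-- such a factorization.  Because φ is invariant under finite modification, no initial state is needed, and
-- replacing σ by σ⁻¹ just reverses the multiplication: the same S and P serve both structures.
-- "The word factors into blocks of value e" is an existential formula, the same one for σ and σ⁻¹.  So φ
-- and ¬φ are preserved by all embeddings between elementary substructures of either structure.
module Submission where

open import Defs
open import Level using (0ℓ)
open import Algebra.Definitions using (Associative)
open import Axiom.ExcludedMiddle using (ExcludedMiddle)
open import Data.Bool using (Bool; true; false; _∧_; _∨_; not)
open import Data.Bool.Properties using (¬-not; ⇔→≡; ∧-assoc; ∧-comm; ∨-identityʳ)
open import Data.Empty using (⊥; ⊥-elim)
open import Data.Fin using (Fin; zero; suc; _↑ˡ_; _↑ʳ_)
open import Data.Nat using (ℕ; zero; suc; _+_; _∸_; _≤_; _<_; z≤n; s≤s; _≟_; _<?_)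
open import Data.Nat.Properties hiding (_≟_; _<?_)
open import Data.Product using (Σ; _×_; _,_; proj₁; proj₂; map₂)
open import Data.Product.Function.NonDependent.Propositional using (_×-⇔_)
open import Data.Sum using (_⊎_; inj₁; inj₂)
open import Data.Sum.Function.Propositional using (_⊎-⇔_)
open import Data.Unit using (⊤; tt)
open import Data.Vec using (Vec; []; _∷_; _++_; head; tail; take; drop; lookup; tabulate)
open import Data.Vec.Properties
  using (take++drop≡id; ++-injectiveˡ; ++-injectiveʳ; tabulate-cong; tabulate∘lookup; lookup∘tabulate)
open import Function using (_∘_; id; flip)
open import Function.Bundles using (_⇔_; mk⇔; module Equivalence)
open import Function.Construct.Composition using (_⇔-∘_)
open import Function.Related.TypeIsomorphisms using (¬-cong-⇔; →-cong-⇔)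
open import Relation.Binary.PropositionalEquality
  using (_≡_; refl; sym; trans; cong; cong₂; subst)
open import Relation.Nullary using (¬_; yes; no; does; contradiction)
open import Relation.Nullary.Decidable using (dec-true; decidable-stable)

open Equivalence using (to; from)

-- Arithmetic modulo finite sets

≈*-refl : ∀ {a} → a ≈* a
≈*-refl = 0 , λ _ _ → refl

≈*-sym : ∀ {a b} → a ≈* b → b ≈* a
≈*-sym (N , eq) = N , λ p N≤p → sym (eq p N≤p)

≈*-trans : ∀ {a b c} → a ≈* b → b ≈* c → a ≈* c
≈*-trans (M , eq) (N , eq′) = M + N , λ p M+N≤p →
  trans (eq p (≤-trans (m≤m+n M N) M+N≤p)) (eq′ p (≤-trans (m≤n+m N M) M+N≤p))

∁-cong : ∀ {a b} → a ≈* b → ∁ a ≈* ∁ b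
∁-cong (N , eq) = N , λ p N≤p → cong not (eq p N≤p)

⊓-cong : ∀ {a a′ b b′} → a ≈* a′ → b ≈* b′ → (a ⊓ b) ≈* (a′ ⊓ b′)
⊓-cong (M , eq) (N , eq′) = M + N , λ p M+N≤p →
  cong₂ _∧_ (eq p (≤-trans (m≤m+n M N) M+N≤p)) (eq′ p (≤-trans (m≤n+m N M) M+N≤p))

⊔-cong : ∀ {a a′ b b′} → a ≈* a′ → b ≈* b′ → (a ⊔ b) ≈* (a′ ⊔ b′)
⊔-cong (M , eq) (N , eq′) = M + N , λ p M+N≤p →
  cong₂ _∨_ (eq p (≤-trans (m≤m+n M N) M+N≤p)) (eq′ p (≤-trans (m≤n+m N M) M+N≤p))

≤*-respˡ : ∀ {a b c} → a ≈* b → a ≤* c → b ≤* c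
≤*-respˡ (M , eq) (N , le) = M + N , λ p M+N≤p bp →
  le p (≤-trans (m≤n+m N M) M+N≤p) (trans (eq p (≤-trans (m≤m+n M N) M+N≤p)) bp)

≤*-respʳ : ∀ {a b c} → b ≈* c → a ≤* b → a ≤* c
≤*-respʳ (M , eq) (N , le) = M + N , λ p M+N≤p ap →
  trans (sym (eq p (≤-trans (m≤m+n M N) M+N≤p))) (le p (≤-trans (m≤n+m N M) M+N≤p) ap)

σ-cong : ∀ {a b} → a ≈* b → σ a ≈* σ b
σ-cong (N , eq) = suc N , λ { (suc p) (s≤s N≤p) → eq p N≤p }

σ⁻¹-cong : ∀ {a b} → a ≈* b → σ⁻¹ a ≈* σ⁻¹ b
σ⁻¹-cong (N , eq) = N , λ p N≤p → eq (suc p) (m≤n⇒m≤1+n N≤p)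

aut-cong : ∀ d {a b} → a ≈* b → aut d a ≈* aut d b
aut-cong fwd = σ-cong
aut-cong bwd = σ⁻¹-cong

autInv-cong : ∀ d {a b} → a ≈* b → autInv d a ≈* autInv d b
autInv-cong fwd = σ⁻¹-cong
autInv-cong bwd = σ-cong

σ-σ⁻¹ : ∀ a → σ (σ⁻¹ a) ≈* a
σ-σ⁻¹ a = 1 , λ { (suc p) _ → refl }

aut-autInv : ∀ d a → aut d (autInv d a) ≈* a
aut-autInv fwd a = σ-σ⁻¹ a
aut-autInv bwd a = ≈*-refl

autInv-aut : ∀ d a → autInv d (aut d a) ≈* a
autInv-aut fwd a = ≈*-refl
autInv-aut bwd a = σ-σ⁻¹ a

≈*-autInv : ∀ d {a b} → b ≈* aut d a → a ≈* autInv d b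
≈*-autInv d b≈ = ≈*-trans (≈*-sym (autInv-aut d _)) (≈*-sym (autInv-cong d b≈))

≈*-autInv⁻ : ∀ d {a b} → a ≈* autInv d b → b ≈* aut d a
≈*-autInv⁻ d a≈ = ≈*-trans (≈*-sym (aut-autInv d _)) (≈*-sym (aut-cong d a≈))

-- Finite semigroups and factorizations of words

StrictlyIncreasing : (ℕ → ℕ) → Set
StrictlyIncreasing g = ∀ n → g n < g (suc n)

increasing-≤ : ∀ {g m n} → StrictlyIncreasing g → m ≤ n → g m ≤ g n
increasing-≤ {n = zero} inc z≤n = ≤-refl
increasing-≤ {n = suc n} inc m≤1+n with m≤n⇒m<n∨m≡n m≤1+n
... | inj₁ (s≤s m≤n) = ≤-trans (increasing-≤ inc m≤n) (<⇒≤ (inc n))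
... | inj₂ refl = ≤-refl

increasing-< : ∀ {g m n} → StrictlyIncreasing g → m < n → g m < g n
increasing-< {m = m} inc m<n = <-≤-trans (inc m) (increasing-≤ inc m<n)

n≤increasing : ∀ {g} → StrictlyIncreasing g → ∀ n → n ≤ g n
n≤increasing inc zero    = z≤n
n≤increasing inc (suc n) = ≤-<-trans (n≤increasing inc n) (inc n)

enumerate : (Q : ℕ → Set) → (∀ N → Σ ℕ λ p → N ≤ p × Q p) → ∀ N →
            Σ (ℕ → ℕ) λ g → StrictlyIncreasing g × N ≤ g 0 × (∀ n → Q (g n))
enumerate Q unbounded N = g , (λ n → proj₁ (proj₂ (unbounded (suc (g n))))) ,
                          proj₁ (proj₂ (unbounded N)) , holds
  where
  g : ℕ → ℕ
  g zero    = proj₁ (unbounded N)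
  g (suc n) = proj₁ (unbounded (suc (g n)))
  holds : ∀ n → Q (g n)
  holds zero    = proj₂ (proj₂ (unbounded N))
  holds (suc n) = proj₂ (proj₂ (unbounded (suc (g n))))

-- Finiteness as a retract of some Vec Bool k: elements can be coded by k subsets of ω.
record Finite (S : Set) : Set where
  field
    bits    : ℕ
    enc     : S → Vec Bool bits
    dec     : Vec Bool bits → S
    dec-enc : ∀ s → dec (enc s) ≡ s

  enc-injective : ∀ {s t} → enc s ≡ enc t → s ≡ t
  enc-injective {s} {t} eq = trans (sym (dec-enc s)) (trans (cong dec eq) (dec-enc t))

finite-Bool : Finite Bool
finite-Bool = record { bits = 1 ; enc = _∷ [] ; dec = head ; dec-enc = λ _ → refl }

finite-× : ∀ {S T} → Finite S → Finite T → Finite (S × T)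
finite-× {S} {T} finS finT = record
  { bits    = F.bits + G.bits
  ; enc     = λ (s , t) → F.enc s ++ G.enc t
  ; dec     = λ v → F.dec (take F.bits v) , G.dec (drop F.bits v)
  ; dec-enc = λ (s , t) → cong₂ _,_
      (trans (cong F.dec (++-injectiveˡ (take F.bits _) _ (take++drop≡id F.bits (F.enc s ++ G.enc t))))
             (F.dec-enc s))
      (trans (cong G.dec (++-injectiveʳ (take F.bits _) (F.enc s) (take++drop≡id F.bits (F.enc s ++ G.enc t))))
             (G.dec-enc t))
  }
  where
  module F = Finite finS
  module G = Finite finT

-- Truth tables, an extensional substitute for functions Vec Bool k → Bool.
Table : ℕ → Set
Table zero    = Bool
Table (suc k) = Table k × Table k

_‼_ : ∀ {k} → Table k → Vec Bool k → Bool
b       ‼ []          = b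
(t , f) ‼ (true ∷ v)  = t ‼ v
(t , f) ‼ (false ∷ v) = f ‼ v

table : ∀ {k} → (Vec Bool k → Bool) → Table k
table {zero}  f = f []
table {suc k} f = table (f ∘ (true ∷_)) , table (f ∘ (false ∷_))

table-‼ : ∀ {k} (f : Vec Bool k → Bool) v → table f ‼ v ≡ f v
table-‼ f []          = refl
table-‼ f (true ∷ v)  = table-‼ (f ∘ (true ∷_)) v
table-‼ f (false ∷ v) = table-‼ (f ∘ (false ∷_)) v

‼-ext : ∀ {k} {E F : Table k} → (∀ v → E ‼ v ≡ F ‼ v) → E ≡ F
‼-ext {zero}  eq = eq []
‼-ext {suc k} eq = cong₂ _,_ (‼-ext (eq ∘ (true ∷_))) (‼-ext (eq ∘ (false ∷_)))

finite-Table : ∀ k → Finite (Table k)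
finite-Table zero    = finite-Bool
finite-Table (suc k) = finite-× (finite-Table k) (finite-Table k)

-- The product of the letters over a nonempty half-open interval. It is a relation because a
-- semigroup has no unit that could serve as value of the empty interval.
data Seg {S : Set} (_·_ : S → S → S) (u : ℕ → S) (i : ℕ) : ℕ → S → Set where
  one  : Seg _·_ u i (suc i) (u i)
  snoc : ∀ {j s} → Seg _·_ u i j s → Seg _·_ u i (suc j) (s · u j)

private
  variable
    S T : Set
    _·_ : S → S → S
    u u′ : ℕ → S
    e s t : S
    g : ℕ → ℕ
    i j k m n p : ℕ

Seg-< : Seg _·_ u i j s → i < j
Seg-< one      = ≤-refl
Seg-< (snoc x) = m≤n⇒m≤1+n (Seg-< x)

Seg-unique : Seg _·_ u i j s → Seg _·_ u i j t → s ≡ t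
Seg-unique one      one      = refl
Seg-unique one      (snoc y) = contradiction (Seg-< y) (n≮n _)
Seg-unique (snoc x) one      = contradiction (Seg-< x) (n≮n _)
Seg-unique {_·_ = _·_} (snoc x) (snoc y) = cong (λ z → z · _) (Seg-unique x y)

Seg-total : ∀ (_·_ : S → S → S) u {i j} → i < j → Σ S (Seg _·_ u i j)
Seg-total _·_ u {i} {suc j} i<1+j with m<1+n⇒m<n∨m≡n i<1+j
... | inj₁ i<j  = _ , snoc (proj₂ (Seg-total _·_ u i<j))
... | inj₂ refl = _ , one

Seg-++ : Associative _≡_ _·_ → Seg _·_ u i j s → Seg _·_ u j k t → Seg _·_ u i k (s · t)
Seg-++ assoc x one      = snoc x
Seg-++ {_·_ = _·_} {u} {i} {s = s} assoc x (snoc {s = t} y) =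
  subst (Seg _·_ u i _) (assoc s t _) (snoc (Seg-++ assoc x y))

Seg-map : (f : S → T) {_·_ : S → S → S} {_•_ : T → T → T} {u : ℕ → S} {u′ : ℕ → T} {s : S} →
          (∀ a b → f (a · b) ≡ f a • f b) →
          (∀ p → i ≤ p → p < j → u′ p ≡ f (u p)) →
          Seg _·_ u i j s → Seg _•_ u′ i j (f s)
Seg-map {i = i} f {u′ = u′} hom eq one =
  subst (Seg _ u′ i (suc i)) (eq i ≤-refl ≤-refl) one
Seg-map {i = i} f {_•_ = _•_} {u′ = u′} hom eq (snoc {j} {s} x) =
  subst (Seg _•_ u′ i (suc j)) (trans (cong (f s •_) (eq j (<⇒≤ (Seg-< x)) ≤-refl)) (sym (hom s _)))
    (snoc (Seg-map f hom (λ p i≤p p<j → eq p i≤p (m≤n⇒m≤1+n p<j)) x))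

Seg-cong : {_·_ : S → S → S} → (∀ p → i ≤ p → p < j → u′ p ≡ u p) → Seg _·_ u i j s → Seg _·_ u′ i j s
Seg-cong = Seg-map id (λ _ _ → refl)

-- Any two cuts are required to enclose value `e`, not only consecutive ones. This is what Ramsey's
-- theorem delivers, and it forces `e` to be idempotent; for idempotent `e`, consecutive cuts
-- suffice.
Factorization : (S → S → S) → (ℕ → S) → S → Set
Factorization _·_ u e = Σ (ℕ → ℕ) λ g → ∀ {m n} → m < n → Seg _·_ u (g m) (g n) e

cuts-increasing : {_·_ : S → S → S} → (∀ {m n} → m < n → Seg _·_ u (g m) (g n) e) → StrictlyIncreasing g
cuts-increasing segs n = Seg-< (segs (n<1+n n))

factorization-idempotent : Associative _≡_ _·_ → Factorization _·_ u e → e · e ≡ e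
factorization-idempotent assoc (g , segs) =
  Seg-unique (Seg-++ assoc (segs (s≤s z≤n)) (segs ≤-refl)) (segs {0} {2} (s≤s z≤n))

factorization-consecutive : Associative _≡_ _·_ → e · e ≡ e →
  (∀ n → Seg _·_ u (g n) (g (suc n)) e) → Factorization _·_ u e
factorization-consecutive {_·_ = _·_} {e = e} {u = u} {g = g} assoc ee≡e blocks = g , segs
  where
  segs : ∀ {m n} → m < n → Seg _·_ u (g m) (g n) e
  segs {n = suc n} m<1+n with m<1+n⇒m<n∨m≡n m<1+n
  ... | inj₁ m<n  = subst (Seg _·_ u _ _) ee≡e (Seg-++ assoc (segs m<n) (blocks n))
  ... | inj₂ refl = blocks n

factorization-map : (f : S → T) {_·_ : S → S → S} {_•_ : T → T → T} {u : ℕ → S} {u′ : ℕ → T} {e : S} →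
  (∀ a b → f (a · b) ≡ f a • f b) → (∀ p → u′ p ≡ f (u p)) →
  Factorization _·_ u e → Factorization _•_ u′ (f e)
factorization-map f hom eq (g , segs) = g , λ m<n → Seg-map f hom (λ p _ _ → eq p) (segs m<n)

directed : Dir → (S → S → S) → S → S → S
directed fwd _·_ = _·_
directed bwd _·_ = flip _·_

directed-assoc : ∀ d {_·_ : S → S → S} → Associative _≡_ _·_ → Associative _≡_ (directed d _·_)
directed-assoc fwd assoc = assoc
directed-assoc bwd assoc a b c = sym (assoc c b a)

directed-hom : ∀ d (f : S → T) {_·_ : S → S → S} {_•_ : T → T → T} → (∀ a b → f (a · b) ≡ f a • f b) →
  ∀ a b → f (directed d _·_ a b) ≡ directed d _•_ (f a) (f b)
directed-hom fwd f hom = hom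
directed-hom bwd f hom = flip hom

directed-square : ∀ d {_·_ : S → S → S} {e} → directed d _·_ e e ≡ e · e
directed-square fwd = refl
directed-square bwd = refl

Env : ℕ → Set
Env n = Fin n → Elem Full

letter : Env n → ℕ → Vec Bool n
letter ρ p = tabulate λ i → proj₁ (ρ i) p

-- σ⁻¹ reads words from right to left, so it multiplies in the opposite semigroup.
record Recognizable {n} (Q : Dir → Env n → Set) : Set₁ where
  field
    Carrier : Set
    finite  : Finite Carrier
    op      : Carrier → Carrier → Carrier
    assoc   : Associative _≡_ op
    value   : Vec Bool n → Carrier
    Accept  : Carrier → Set
    correct : ∀ d ρ {e} → Factorization (directed d op) (λ p → value (letter ρ p)) e → Accept e ⇔ Q d ρ

module Classical (em : ExcludedMiddle 0ℓ) where

  -- Pigeonhole principle, Ramsey's theorem and blocks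

  infinitely-often : ∀ {a} → ¬ (a ≈* 𝟎) → ∀ N → Σ ℕ λ p → N ≤ p × a p ≡ true
  infinitely-often {a} a≉𝟎 N with em {Σ ℕ λ p → N ≤ p × a p ≡ true}
  ... | yes found = found
  ... | no none   = contradiction (N , λ p N≤p → ¬-not λ ap → none (p , N≤p , ap)) a≉𝟎

  MonochromaticSubsequence : (ℕ → S) → Set
  MonochromaticSubsequence {S} c = Σ S λ s → Σ (ℕ → ℕ) λ g → StrictlyIncreasing g × (∀ n → c (g n) ≡ s)

  pigeonhole-Bool : (c : ℕ → Bool) → MonochromaticSubsequence c
  pigeonhole-Bool c with em {c ≈* 𝟎}
  ... | yes (N , c≡false) = false , (N +_) , (λ n → +-monoʳ-< N ≤-refl) , (λ n → c≡false _ (m≤m+n N n))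
  ... | no c≉𝟎 with enumerate (λ p → c p ≡ true) (infinitely-often c≉𝟎) 0
  ...   | g , inc , _ , c≡true = true , g , inc , c≡true

  pigeonhole-Vec : ∀ {k} (c : ℕ → Vec Bool k) → MonochromaticSubsequence c
  pigeonhole-Vec {zero}  c = [] , id , (λ n → ≤-refl) , λ n → nil (c n)
    where
    nil : (v : Vec Bool 0) → v ≡ []
    nil [] = refl
  pigeonhole-Vec {suc k} c with pigeonhole-Bool (head ∘ c)
  ... | b , g , g-inc , heads with pigeonhole-Vec (tail ∘ c ∘ g)
  ...   | v , h , h-inc , tails =
    b ∷ v , g ∘ h , (λ n → increasing-< g-inc (h-inc n)) ,
    λ n → trans (η (c (g (h n)))) (cong₂ _∷_ (heads (h n)) (tails n))
    where
    η : (w : Vec Bool (suc k)) → w ≡ head w ∷ tail w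
    η (_ ∷ _) = refl

  pigeonhole : Finite S → (c : ℕ → S) → MonochromaticSubsequence c
  pigeonhole fin c with pigeonhole-Vec (Finite.enc fin ∘ c)
  ... | v , g , inc , eq =
    Finite.dec fin v , g , inc , λ n → trans (sym (Finite.dec-enc fin _)) (cong (Finite.dec fin) (eq n))

  module Ramsey (fin : Finite S) (R : ℕ → ℕ → S → Set) (colour : ∀ {i j} → i < j → Σ S (R i j)) where

    Subsequence : Set
    Subsequence = Σ (ℕ → ℕ) StrictlyIncreasing

    -- Infinitely many later terms of `G` have the same colour with its first term, and `H` consists
    -- of these. The index bound `0 < m` makes `H` start strictly after that first term.
    refine : (G : Subsequence) → Σ S λ s → Σ Subsequence λ H →
      (∀ n → R (proj₁ G 0) (proj₁ H n) s) × (∀ n → Σ ℕ λ m → 0 < m × proj₁ H n ≡ proj₁ G m)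
    refine (g , inc) with pigeonhole fin (λ n → proj₁ (colour (increasing-< inc (s≤s (z≤n {n})))))
    ... | s , h , h-inc , eq =
      s , (g ∘ suc ∘ h , λ n → increasing-< inc (s≤s (h-inc n))) ,
      (λ n → subst (R (g 0) (g (suc (h n)))) (eq n) (proj₂ (colour (increasing-< inc (s≤s z≤n))))) ,
      λ n → suc (h n) , s≤s z≤n , refl

    stage : ℕ → Subsequence
    stage zero    = id , λ n → ≤-refl
    stage (suc n) = proj₁ (proj₂ (refine (stage n)))

    point : ℕ → ℕ
    point n = proj₁ (stage n) 0

    stage-⊆ : ∀ k m n → Σ ℕ λ n′ → proj₁ (stage (k + m)) n ≡ proj₁ (stage m) n′
    stage-⊆ zero    m n = n , refl
    stage-⊆ (suc k) m n with proj₂ (proj₂ (proj₂ (refine (stage (k + m))))) n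
    ... | n′ , _ , eq with stage-⊆ k m n′
    ...   | n″ , eq′ = n″ , trans eq eq′

    point-increasing : StrictlyIncreasing point
    point-increasing n with proj₂ (proj₂ (proj₂ (refine (stage n)))) 0
    ... | m , 0<m , eq = subst (point n <_) (sym eq) (increasing-< (proj₂ (stage n)) 0<m)

    -- The colour depends on the smaller point only: `point n` is a member of stage `suc m`, all of
    -- whose members have one colour with `point m`.
    point-colour : m < n → R (point m) (point n) (proj₁ (refine (stage m)))
    point-colour {m} {n} m<n with stage-⊆ (n ∸ suc m) (suc m) 0
    ... | n′ , eq rewrite m∸n+n≡m m<n =
      subst (λ j → R (point m) j _) (sym eq) (proj₁ (proj₂ (proj₂ (refine (stage m)))) n′)

    ramsey : Σ S λ s → Σ (ℕ → ℕ) λ g → StrictlyIncreasing g × (∀ {m n} → m < n → R (g m) (g n) s)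
    -- A second pigeonhole makes the colour independent of the smaller point as well.
    ramsey with pigeonhole fin (λ n → proj₁ (refine (stage n)))
    ... | s , h , h-inc , eq =
      s , point ∘ h , (λ n → increasing-< point-increasing (h-inc n)) ,
      λ m<n → subst (R _ _) (eq _) (point-colour (increasing-< h-inc m<n))

  open Ramsey using (ramsey)

  abstract
    -- The new cuts are chosen among the values of a given `g`, so that a factorization in one
    -- semigroup can be coarsened to one that also works in another.
    factorize : Finite S → (_·_ : S → S → S) (u : ℕ → S) → StrictlyIncreasing g →
      Σ S λ e → Σ (ℕ → ℕ) λ h → StrictlyIncreasing h × (∀ {m n} → m < n → Seg _·_ u (g (h m)) (g (h n)) e)
    factorize {g = g} fin _·_ u inc =
      ramsey fin (λ i j → Seg _·_ u (g i) (g j)) (λ i<j → Seg-total _·_ u (increasing-< inc i<j))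

  factorization-exists : Finite S → (_·_ : S → S → S) (u : ℕ → S) → Σ S (Factorization _·_ u)
  factorization-exists fin _·_ u with factorize {g = id} fin _·_ u (λ _ → ≤-refl)
  ... | e , h , _ , segs = e , h , segs

  InBlock : (ℕ → ℕ) → ℕ → ℕ → Set
  InBlock g p n = g n ≤ p × p < g (suc n)

  block-≤ : StrictlyIncreasing g → g m ≤ p → p < g (suc n) → m ≤ n
  block-≤ {m = m} {n = n} inc gm≤p p<gn⁺ with m <? suc n
  ... | yes (s≤s m≤n) = m≤n
  ... | no m≮1+n = contradiction (≤-<-trans (≤-trans (increasing-≤ inc (≮⇒≥ m≮1+n)) gm≤p) p<gn⁺) (n≮n _)

  block-unique : StrictlyIncreasing g → InBlock g p m → InBlock g p n → m ≡ n
  block-unique inc (gm≤p , p<gm⁺) (gn≤p , p<gn⁺) = ≤-antisym (block-≤ inc gm≤p p<gn⁺) (block-≤ inc gn≤p p<gm⁺)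

  block-exists : StrictlyIncreasing g → g 0 ≤ p → Σ ℕ (InBlock g p)
  block-exists {g} {zero}  inc g0≤p = 0 , g0≤p , ≤-<-trans z≤n (inc 0)
  block-exists {g} {suc p} inc g0≤1+p with m≤n⇒m<n∨m≡n g0≤1+p
  ... | inj₂ eq = 0 , g0≤1+p , subst (_< g 1) eq (inc 0)
  ... | inj₁ (s≤s g0≤p) with block-exists inc g0≤p
  ...   | n , gn≤p , p<gn⁺ with m≤n⇒m<n∨m≡n p<gn⁺
  ...     | inj₁ 1+p<gn⁺ = n , m≤n⇒m≤1+n gn≤p , 1+p<gn⁺
  ...     | inj₂ eq      = suc n , ≤-reflexive (sym eq) , subst (_< g (suc (suc n))) (sym eq) (inc (suc n))

  -- A decision of a Σ-type carries a witness, so excluded middle yields a choice function.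
  choose : (Q : ℕ → S → Set) → (∀ p → S) → ℕ → S
  choose {S} Q default p with em {Σ S (Q p)}
  ... | yes (s , _) = s
  ... | no _        = default p

  choose-spec : (Q : ℕ → S → Set) (default : ∀ p → S) → Q p s → Q p (choose Q default p)
  choose-spec {S} {p = p} Q default q with em {Σ S (Q p)}
  ... | yes (_ , q′) = q′
  ... | no none      = contradiction (_ , q) none

  -- Closure properties of recognizable predicates

  decide : Set → Bool
  decide A = does (em {A})

  decide-⇔ : ∀ {A} → decide A ≡ true ⇔ A
  decide-⇔ {A} = mk⇔ sound (dec-true em)
    where
    sound : decide A ≡ true → A
    sound eq with em {A}
    ... | yes a = a
    sound () | no _

  recognizable-⇔ : ∀ {n} {Q Q′ : Dir → Env n → Set} → (∀ d ρ → Q d ρ ⇔ Q′ d ρ) → Recognizable Q → Recognizable Q′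
  recognizable-⇔ eq R = record { Recognizable R ; correct = λ d ρ f → eq d ρ ⇔-∘ Recognizable.correct R d ρ f }

  -- In the product semigroup a factorization projects to factorizations in both factors, so every
  -- connective that respects `⇔` can be computed on the two `Accept` predicates.
  recognizable-binary : ∀ {n} {Q Q′ : Dir → Env n → Set} (_∙_ : Set → Set → Set) →
    (∀ {A B C D} → A ⇔ C → B ⇔ D → (A ∙ B) ⇔ (C ∙ D)) →
    Recognizable Q → Recognizable Q′ → Recognizable (λ d ρ → Q d ρ ∙ Q′ d ρ)
  recognizable-binary _∙_ ∙-cong R R′ = record
    { Carrier = R.Carrier × R′.Carrier
    ; finite  = finite-× R.finite R′.finite
    ; op      = λ (a , b) (a′ , b′) → R.op a a′ , R′.op b b′
    ; assoc   = λ (a , b) (a′ , b′) (a″ , b″) → cong₂ _,_ (R.assoc a a′ a″) (R′.assoc b b′ b″)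
    ; value   = λ v → R.value v , R′.value v
    ; Accept  = λ (a , b) → R.Accept a ∙ R′.Accept b
    ; correct = λ d ρ f → ∙-cong
        (R.correct d ρ (factorization-map proj₁ (directed-hom d proj₁ (λ _ _ → refl)) (λ _ → refl) f))
        (R′.correct d ρ (factorization-map proj₂ (directed-hom d proj₂ (λ _ _ → refl)) (λ _ → refl) f))
    }
    where
    module R = Recognizable R
    module R′ = Recognizable R′

  -- Complementation costs nothing because `correct` speaks of every factorization with value `e`,
  -- not of the existence of a suitable one.
  recognizable-¬ : ∀ {n} {Q : Dir → Env n → Set} → Recognizable Q → Recognizable (λ d ρ → ¬ Q d ρ)
  recognizable-¬ R = record
    { Recognizable R
    ; Accept  = ¬_ ∘ Recognizable.Accept R
    ; correct = λ d ρ f → ¬-cong-⇔ (Recognizable.correct R d ρ f)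
    }

  recognizable-rename : ∀ {m n} {Q : Dir → Env m → Set} (r : Fin m → Fin n) →
    Recognizable Q → Recognizable (λ d ρ → Q d (λ i → ρ (r i)))
  recognizable-rename r R = record
    { Recognizable R
    ; value   = λ v → R.value (tabulate λ i → lookup v (r i))
    ; correct = λ d ρ f → R.correct d (λ i → ρ (r i)) (factorization-map id (λ _ _ → refl)
        (λ p → cong R.value (tabulate-cong λ i → sym (lookup∘tabulate _ (r i)))) f)
    }
    where
    module R = Recognizable R

  -- The power semigroup and projection

  module Power {S : Set} (fin : Finite S) (_·_ : S → S → S) (assoc : Associative _≡_ _·_) where
    open Finite fin

    _∈_ : S → Table bits → Set
    s ∈ E = E ‼ enc s ≡ true

    ⟪_⟫ : (Vec Bool bits → Set) → Table bits
    ⟪ A ⟫ = table (λ v → decide (A v))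

    ⟪⟫-⇔ : ∀ {A} v → ⟪ A ⟫ ‼ v ≡ true ⇔ A v
    ⟪⟫-⇔ {A} v = mk⇔ (λ eq → to decide-⇔ (trans (sym (table-‼ (λ w → decide (A w)) v)) eq))
                     (λ a → trans (table-‼ (λ w → decide (A w)) v) (from decide-⇔ a))

    -- The predicate is false on bit vectors that code no element, so products are determined by
    -- their members; associativity can then be an equality of tables.
    Product : Table bits → Table bits → Vec Bool bits → Set
    Product E F v = Σ S λ a → Σ S λ b → a ∈ E × b ∈ F × v ≡ enc (a · b)

    _⊛_ : Table bits → Table bits → Table bits
    E ⊛ F = ⟪ Product E F ⟫

    ⊛-⇔ : ∀ {E F} v → (E ⊛ F) ‼ v ≡ true ⇔ Product E F v
    ⊛-⇔ {E} {F} = ⟪⟫-⇔ {Product E F}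

    ∈-⊛ : ∀ {E F s} → s ∈ (E ⊛ F) ⇔ Σ S λ a → Σ S λ b → a ∈ E × b ∈ F × s ≡ a · b
    ∈-⊛ {s = s} = mk⇔
      (λ m → let (a , b , a∈ , b∈ , eq) = to (⊛-⇔ (enc s)) m in a , b , a∈ , b∈ , enc-injective eq)
      (λ (a , b , a∈ , b∈ , eq) → from (⊛-⇔ (enc s)) (a , b , a∈ , b∈ , cong enc eq))

    ⊛-assoc : Associative _≡_ _⊛_
    ⊛-assoc E F G = ‼-ext λ v → ⇔→≡ (mk⇔
      (λ m → let (c , d , c∈ , d∈ , eq) = to (⊛-⇔ v) m
                 (a , b , a∈ , b∈ , eq′) = to ∈-⊛ c∈
             in from (⊛-⇔ v) (a , b · d , a∈ , from ∈-⊛ (b , d , b∈ , d∈ , refl) ,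
                  trans eq (cong enc (trans (cong (_· d) eq′) (assoc a b d)))))
      (λ m → let (c , d , c∈ , d∈ , eq) = to (⊛-⇔ v) m
                 (a , b , a∈ , b∈ , eq′) = to ∈-⊛ d∈
             in from (⊛-⇔ v) (c · a , b , from ∈-⊛ (c , a , c∈ , a∈ , refl) , b∈ ,
                  trans eq (cong enc (trans (cong (c ·_) eq′) (sym (assoc c a b)))))))

    ∈-directed-⊛ : ∀ dir {E F s} → s ∈ directed dir _⊛_ E F ⇔ (Σ S λ a → Σ S λ b → a ∈ E × b ∈ F × s ≡ directed dir _·_ a b)
    ∈-directed-⊛ fwd = ∈-⊛
    ∈-directed-⊛ bwd = mk⇔
      (λ m → let (a , b , a∈ , b∈ , eq) = to ∈-⊛ m in b , a , b∈ , a∈ , eq)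
      (λ (a , b , a∈ , b∈ , eq) → from ∈-⊛ (b , a , b∈ , a∈ , eq))

    module _ {n} (value : Vec Bool (suc n) → S) where

      Value : Vec Bool n → Vec Bool bits → Set
      Value w v = Σ Bool λ b → v ≡ enc (value (b ∷ w))

      values : Vec Bool n → Table bits
      values w = ⟪ Value w ⟫

      ∈-values : ∀ {w s} → s ∈ values w ⇔ Σ Bool λ b → s ≡ value (b ∷ w)
      ∈-values {w} {s} = mk⇔ (λ m → map₂ enc-injective (to (⟪⟫-⇔ {Value w} (enc s)) m))
                             (λ m → from (⟪⟫-⇔ {Value w} (enc s)) (map₂ (cong enc) m))

      module _ (dir : Dir) (w : ℕ → Vec Bool n) where

        private
          ω : Pω → ℕ → S
          ω x p = value (x p ∷ w p)

        project : ∀ {E x} → Seg (directed dir _⊛_) (values ∘ w) i j E → Seg (directed dir _·_) (ω x) i j s → s ∈ E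
        project one      one      = from ∈-values (_ , refl)
        project one      (snoc y) = contradiction (Seg-< y) (n≮n _)
        project (snoc y) one      = contradiction (Seg-< y) (n≮n _)
        project (snoc y) (snoc z) =
          from (∈-directed-⊛ dir) (_ , _ , project y z , from ∈-values (_ , refl) , refl)

        -- Induction on the segment: the last factor fixes the bit of `x` at the last position, and
        -- overwriting `x` there leaves the value of the earlier segment unchanged.
        realize : ∀ {E} → Seg (directed dir _⊛_) (values ∘ w) i j E → s ∈ E → Σ Pω λ x → Seg (directed dir _·_) (ω x) i j s
        realize {i} one s∈ with to ∈-values s∈
        ... | b , refl = (λ _ → b) , one
        realize {i} (snoc {j} y) s∈ with to (∈-directed-⊛ dir) s∈
        ... | a , c , a∈ , c∈ , refl with realize y a∈ | to ∈-values c∈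
        ...   | x , z | b , refl =
          x′ , subst (λ q → Seg (directed dir _·_) (ω x′) i (suc j) (directed dir _·_ a (value (q ∷ w j)))) x′-at-j
                 (snoc (Seg-cong x′-before-j z))
          where
          x′ : Pω
          x′ p with p ≟ j
          ... | yes _ = b
          ... | no _  = x p
          x′-at-j : x′ j ≡ b
          x′-at-j with j ≟ j
          ... | yes _  = refl
          ... | no j≢j = contradiction refl j≢j
          x′-before-j : ∀ p → i ≤ p → p < j → ω x′ p ≡ ω x p
          x′-before-j p _ p<j with p ≟ j
          ... | yes p≡j = contradiction p≡j (<⇒≢ p<j)
          ... | no _    = refl

  -- A word is projected to a product E of sets of values.  Since consecutive blocks can be completed
  -- independently, any idempotent e ∈ E is realised by some completion, in either direction.
  recognizable-∃ : ∀ {n} {Q : Dir → Env (suc n) → Set} →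
    Recognizable Q → Recognizable (λ d ρ → Σ (Elem Full) λ x → Q d (extend x ρ))
  recognizable-∃ {n} {Q} R = record
    { Carrier = Table (Finite.bits R.finite)
    ; finite  = finite-Table _
    ; op      = _⊛_
    ; assoc   = ⊛-assoc
    ; value   = values R.value
    ; Accept  = Accept
    ; correct = λ d ρ f → mk⇔ (complete d ρ f) (restrict d ρ f)
    }
    where
    module R = Recognizable R
    open Power R.finite R.op R.assoc

    -- Idempotency of `e` is demanded so that blocks completed separately, each with value `e`,
    -- combine into a factorization.
    Accept : Table (Finite.bits R.finite) → Set
    Accept E = Σ R.Carrier λ e → e ∈ E × R.op e e ≡ e × R.Accept e

    complete : ∀ d ρ {E} → Factorization (directed d _⊛_) (λ p → values R.value (letter ρ p)) E →
               Accept E → Σ (Elem Full) λ x → Q d (extend x ρ)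
    complete d ρ (g , segs) (e , e∈E , ee≡e , acc) = (x , tt) , to (R.correct d (extend (x , tt) ρ)
      (factorization-consecutive (directed-assoc d R.assoc) (trans (directed-square d) ee≡e) blocks)) acc
      where
      g-inc : StrictlyIncreasing g
      g-inc = cuts-increasing segs
      piece : ∀ n → Σ Pω λ y → Seg (directed d R.op) (λ p → R.value (y p ∷ letter ρ p)) (g n) (g (suc n)) e
      piece n = realize R.value d (letter ρ) (segs ≤-refl) e∈E
      Agrees : ℕ → Bool → Set
      Agrees p b = Σ ℕ λ n → InBlock g p n × b ≡ proj₁ (piece n) p
      x : Pω
      -- From `g 0` on each position lies in exactly one block, so the pieces glue together; earlier
      -- positions belong to no segment and receive `false`.
      x = choose Agrees (λ _ → false)
      x-agrees : ∀ n p → g n ≤ p → p < g (suc n) → x p ≡ proj₁ (piece n) p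
      x-agrees n p gn≤p p<gn⁺ with choose-spec Agrees (λ _ → false) (n , (gn≤p , p<gn⁺) , refl)
      ... | n′ , inBlock , eq with block-unique g-inc inBlock (gn≤p , p<gn⁺)
      ...   | refl = eq
      blocks : ∀ n → Seg (directed d R.op) (λ p → R.value (x p ∷ letter ρ p)) (g n) (g (suc n)) e
      blocks n = Seg-cong (λ p gn≤p p<gn⁺ → cong (λ b → R.value (b ∷ letter ρ p)) (x-agrees n p gn≤p p<gn⁺))
                   (proj₂ (piece n))

    restrict : ∀ d ρ {E} → Factorization (directed d _⊛_) (λ p → values R.value (letter ρ p)) E →
               Σ (Elem Full) (λ x → Q d (extend x ρ)) → Accept E
    restrict d ρ (g , segs) (x , q)
      -- The cuts for the completed word are taken among those of the given factorization. A block
      -- between two of them has value `E` before and `e` after completion, whence `e ∈ E`.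
      with factorize R.finite (directed d R.op) (λ p → R.value (letter (extend x ρ) p)) (cuts-increasing segs)
    ... | e , h , h-inc , segs′ =
      e , project R.value d (letter ρ) (segs (h-inc 0)) (segs′ ≤-refl) ,
      trans (sym (directed-square d)) (factorization-idempotent (directed-assoc d R.assoc) f) ,
      from (R.correct d (extend x ρ) f) q
      where
      f : Factorization (directed d R.op) (λ p → R.value (letter (extend x ρ) p)) e
      f = g ∘ h , segs′

  -- Basic recognizable predicates: pointwise conditions and the shift

  Eventually : (ℕ → Set) → Set
  Eventually C = Σ ℕ λ N → ∀ p → N ≤ p → C p

  ∧-⇔ : ∀ {a b} → a ∧ b ≡ true ⇔ (a ≡ true × b ≡ true)
  ∧-⇔ {true}  = mk⇔ (refl ,_) proj₂
  ∧-⇔ {false} = mk⇔ (λ ()) (λ ())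

  module _ {n} (C : Vec Bool n → Set) where

    private
      everywhere : ∀ d (w : ℕ → Vec Bool n) {b} → Seg (directed d _∧_) (decide ∘ C ∘ w) i j b →
                   b ≡ true ⇔ (∀ p → i ≤ p → p < j → C (w p))
      everywhere {i} d w one = mk⇔
        (λ eq p i≤p p<j → subst (C ∘ w) (≤-antisym i≤p (m<1+n⇒m≤n p<j)) (to decide-⇔ eq))
        (λ all → from decide-⇔ (all i ≤-refl ≤-refl))
      everywhere {i} d w (snoc {j} {b} x) = mk⇔ (split d)
        (λ all → join d (from (everywhere d w x) (λ p i≤p p<j → all p i≤p (m≤n⇒m≤1+n p<j)))
                        (from decide-⇔ (all j (<⇒≤ (Seg-< x)) ≤-refl)))
        where
        extendTo : b ≡ true → decide (C (w j)) ≡ true → ∀ p → i ≤ p → p < suc j → C (w p)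
        extendTo eq eq′ p i≤p p<1+j with m<1+n⇒m<n∨m≡n p<1+j
        ... | inj₁ p<j  = to (everywhere d w x) eq p i≤p p<j
        ... | inj₂ refl = to decide-⇔ eq′
        split : ∀ d′ → directed d′ _∧_ b (decide (C (w j))) ≡ true → ∀ p → i ≤ p → p < suc j → C (w p)
        split fwd eq = let (l , r) = to ∧-⇔ eq in extendTo l r
        split bwd eq = let (l , r) = to ∧-⇔ eq in extendTo r l
        join : ∀ d′ → b ≡ true → decide (C (w j)) ≡ true → directed d′ _∧_ b (decide (C (w j))) ≡ true
        join fwd l r = from ∧-⇔ (l , r)
        join bwd l r = from ∧-⇔ (r , l)

    -- Values are multiplied by conjunction. If `C` holds from `N` on, the block starting at cut
    -- `N`, which is at least `N`, has value `true`; all blocks share one value, so `true`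
    -- conversely gives `C` from the first cut on.
    recognizable-eventually : Recognizable (λ _ ρ → Eventually (C ∘ letter ρ))
    recognizable-eventually = record
      { Carrier = Bool
      ; finite  = finite-Bool
      ; op      = _∧_
      ; assoc   = ∧-assoc
      ; value   = decide ∘ C
      ; Accept  = _≡ true
      ; correct = λ d ρ (g , segs) → mk⇔
          (λ eq → g 0 , λ p g0≤p → to (everywhere d (letter ρ) (segs (s≤s z≤n))) eq p g0≤p
                                      (n≤increasing (cuts-increasing segs) (suc p)))
          (λ (N , all) → from (everywhere d (letter ρ) (segs (≤-refl {suc N})))
            (λ p gN≤p _ → all p (≤-trans (n≤increasing (cuts-increasing segs) N) gN≤p)))
      }

  module Shift where

    -- First value of y, last value of z, and whether all adjacent pairs in between are linked.
    Link : Set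
    Link = Bool × Bool × Bool

    link : Link → Link → Link
    link (a , b , o) (a′ , b′ , o′) = a , b′ , (o ∧ o′) ∧ decide (b ≡ a′)

    link-assoc : Associative _≡_ link
    link-assoc (a , b , o) (a′ , b′ , o′) (a″ , b″ , o″) =
      cong (λ q → a , b″ , q) (rearrange o o′ o″ (decide (b ≡ a′)) (decide (b′ ≡ a″)))
      where
      rearrange : ∀ o o′ o″ q q′ → (((o ∧ o′) ∧ q) ∧ o″) ∧ q′ ≡ (o ∧ ((o′ ∧ o″) ∧ q′)) ∧ q
      rearrange false o′    o″ q q′ = refl
      rearrange true  false o″ q q′ = refl
      rearrange true  true  o″ q q′ = trans (∧-assoc q o″ q′) (∧-comm q (o″ ∧ q′))

    ok : Link → Bool
    ok (_ , _ , o) = o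

    single : Vec Bool 2 → Link
    single (y ∷ z ∷ []) = y , z , true

    module _ (y z : Pω) where

      Linked : Dir → ℕ → Set
      Linked fwd p = z p ≡ y (suc p)
      Linked bwd p = z (suc p) ≡ y p

      -- Under `bwd` a new letter is multiplied on the left, so the position read last is visible in
      -- the first component, through `y`.
      LastIs : Dir → Link → ℕ → Set
      LastIs fwd (_ , b , _) p = b ≡ z p
      LastIs bwd (a , _ , _) p = a ≡ y p

      letters : ℕ → Vec Bool 2
      letters p = y p ∷ z p ∷ []

      seg-last : ∀ d {s} → Seg (directed d link) (single ∘ letters) i (suc j) s → LastIs d s j
      seg-last fwd one      = refl
      seg-last fwd (snoc _) = refl
      seg-last bwd one      = refl
      seg-last bwd (snoc _) = refl

      ok-snoc : ∀ d {s} → LastIs d s j →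
        ok (directed d link s (single (letters (suc j)))) ≡ true ⇔ (ok s ≡ true × Linked d j)
      ok-snoc fwd refl = mk⇔
        (λ eq → let (l , r) = to ∧-⇔ eq in proj₁ (to ∧-⇔ l) , to decide-⇔ r)
        (λ (l , r) → from ∧-⇔ (from ∧-⇔ (l , refl) , from decide-⇔ r))
      ok-snoc bwd refl = mk⇔
        (λ eq → let (l , r) = to ∧-⇔ eq in l , to decide-⇔ r)
        (λ (l , r) → from ∧-⇔ (l , from decide-⇔ r))

      ok-⇔ : ∀ d {s} → Seg (directed d link) (single ∘ letters) i j s →
             ok s ≡ true ⇔ (∀ p → i ≤ p → suc p < j → Linked d p)
      ok-⇔ d one = mk⇔ (λ _ p i≤p 1+p<1+i → contradiction (≤-<-trans i≤p (<-pred 1+p<1+i)) (n≮n _)) (λ _ → refl)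
      ok-⇔ d (snoc {zero} x) = contradiction (Seg-< x) λ ()
      ok-⇔ {i = i} d (snoc {suc j} {s} x) = mk⇔ sound
        (λ all → from (ok-snoc d (seg-last d x))
          (from (ok-⇔ d x) (λ p i≤p lt → all p i≤p (m≤n⇒m≤1+n lt)) , all j (m<1+n⇒m≤n (Seg-< x)) ≤-refl))
        where
        sound : ok (directed d link s (single (letters (suc j)))) ≡ true → ∀ p → i ≤ p → suc p < suc (suc j) → Linked d p
        sound eq p i≤p lt with to (ok-snoc d (seg-last d x)) eq | m<1+n⇒m<n∨m≡n (<-pred lt)
        ... | eq′ , _      | inj₁ p<j  = to (ok-⇔ d x) eq′ p i≤p (s≤s p<j)
        ... | _   , linked | inj₂ refl = linked

      linked-⇔ : ∀ d → Eventually (Linked d) ⇔ y ≈* aut d z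
      linked-⇔ fwd = mk⇔
        (λ (N , linked) → suc N , λ { (suc p) (s≤s N≤p) → sym (linked p N≤p) })
        (λ (N , eq) → N , λ p N≤p → sym (eq (suc p) (m≤n⇒m≤1+n N≤p)))
      linked-⇔ bwd = mk⇔ (λ (N , eq) → N , λ p N≤p → sym (eq p N≤p)) (λ (N , eq) → N , λ p N≤p → sym (eq p N≤p))

    -- A product compares the last `z` of the left factor with the first `y` of the right one. Read
    -- forwards this says `y (suc p) ≡ z p`, read backwards `y p ≡ z (suc p)`: the graphs of σ and
    -- σ⁻¹.
    recognizable-aut : Recognizable {2} (λ d ρ → proj₁ (ρ zero) ≈* aut d (proj₁ (ρ (suc zero))))
    recognizable-aut = record
      { Carrier = Link
      ; finite  = finite-× finite-Bool (finite-× finite-Bool finite-Bool)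
      ; op      = link
      ; assoc   = link-assoc
      ; value   = single
      ; Accept  = λ s → ok s ≡ true
      ; correct = λ d ρ (g , segs) → linked-⇔ (proj₁ (ρ zero)) (proj₁ (ρ (suc zero))) d ⇔-∘ mk⇔
          -- The cut with index `suc (suc p)` lies beyond both `p` and `suc p`, so the segment
          -- contains the whole pair.
          (λ eq → g 0 , λ p g0≤p → to (ok-⇔ _ _ d (segs (s≤s z≤n))) eq p g0≤p
                                      (n≤increasing (cuts-increasing segs) (suc (suc p))))
          (λ (N , all) → from (ok-⇔ _ _ d (segs (≤-refl {suc N})))
            (λ p gN≤p _ → all p (≤-trans (n≤increasing (cuts-increasing segs) N) gN≤p)))
      }

  open Shift using (recognizable-aut)

  -- Recognizability of terms and formulas

  Graph : ∀ {n} → (Dir → Env n → Pω) → Dir → Env (suc n) → Set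
  Graph V d ρ = proj₁ (ρ zero) ≈* V d (λ i → ρ (suc i))

  recognizable-weaken : ∀ {n} {V : Dir → Env n → Pω} →
    Recognizable (Graph V) → Recognizable (Graph {suc n} λ d ρ → V d (λ i → ρ (suc i)))
  recognizable-weaken {n} R = recognizable-rename skip R
    where
    skip : Fin (suc n) → Fin (suc (suc n))
    skip zero    = zero
    skip (suc i) = suc (suc i)

  -- Substituting `V` amounts to quantifying existentially over a set in its graph. The graph fixes
  -- this set only modulo finite sets, so `Q` must be invariant under `≈*`.
  recognizable-subst : ∀ {n} {Q : Dir → Env (suc n) → Set} {V : Dir → Env n → Pω} →
    (∀ d ρ {a b} → a ≈* b → Q d (extend (a , tt) ρ) → Q d (extend (b , tt) ρ)) →
    Recognizable Q → Recognizable (Graph V) → Recognizable (λ d ρ → Q d (extend (V d ρ , tt) ρ))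
  recognizable-subst {V = V} resp R G = recognizable-⇔
    (λ d ρ → mk⇔ (λ (x , x≈V , q) → resp d ρ x≈V q) (λ q → (V d ρ , tt) , ≈*-refl , q))
    (recognizable-∃ (recognizable-binary _×_ _×-⇔_ G R))

  pair : ∀ {n} → Fin n → Fin n → Fin 2 → Fin n
  pair i j zero       = i
  pair i j (suc zero) = j

  triple : ∀ {n} → Fin n → Fin n → Fin n → Fin 3 → Fin n
  triple i j k zero    = i
  triple i j k (suc l) = pair j k l

  recognizable-≈ : Recognizable {2} (λ _ ρ → proj₁ (ρ zero) ≈* proj₁ (ρ (suc zero)))
  recognizable-≈ = recognizable-eventually λ { (a ∷ b ∷ []) → a ≡ b }

  ⟦_⟧ : ∀ {n} → Term n → Dir → Env n → Pω
  ⟦ t ⟧ d ρ = evalT d (λ i → proj₁ (ρ i)) t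

  recognizable-unary : ∀ {n} {V : Dir → Env n → Pω} (G : Dir → Pω → Pω) →
    (∀ d {a b} → a ≈* b → G d a ≈* G d b) →
    Recognizable {2} (λ d ρ → proj₁ (ρ zero) ≈* G d (proj₁ (ρ (suc zero)))) →
    Recognizable (Graph V) → Recognizable (Graph λ d ρ → G d (V d ρ))
  recognizable-unary {V = V} G G-cong R RV = recognizable-subst
    (λ d ρ a≈b y≈Ga → ≈*-trans y≈Ga (G-cong d a≈b))
    (recognizable-rename (pair (suc zero) zero) R) (recognizable-weaken {V = V} RV)

  recognizable-binaryOp : ∀ {n} {V W : Dir → Env n → Pω} (op : Bool → Bool → Bool) →
    Recognizable (Graph V) → Recognizable (Graph W) → Recognizable (Graph λ d ρ p → op (V d ρ p) (W d ρ p))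
  recognizable-binaryOp {V = V} {W} op RV RW = recognizable-subst
    {Q = λ d ρ → proj₁ (ρ (suc zero)) ≈* (λ p → op (proj₁ (ρ zero) p) (W d (λ i → ρ (suc (suc i))) p))}
    (λ d ρ a≈b y≈ → ≈*-trans y≈ (pointwise (λ p a → op a (W d (λ i → ρ (suc i)) p)) a≈b))
    (recognizable-subst
      (λ d ρ a≈b y≈ → ≈*-trans y≈ (pointwise (λ p → op (proj₁ (ρ zero) p)) a≈b))
      -- Index 2 is the result `y`, index 1 the value of `V` and index 0 the value of `W`, the last
      -- one being quantified innermost.
      (recognizable-rename (triple (suc (suc zero)) (suc zero) zero)
        (recognizable-eventually λ { (y ∷ a ∷ b ∷ []) → y ≡ op a b }))
      (recognizable-weaken {V = λ d ρ → W d (λ i → ρ (suc i))} (recognizable-weaken {V = W} RW)))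
    (recognizable-weaken {V = V} RV)
    where
    pointwise : ∀ {a b : Pω} (f : ℕ → Bool → Bool) → a ≈* b → (λ p → f p (a p)) ≈* (λ p → f p (b p))
    pointwise f (N , eq) = N , λ p N≤p → cong (f p) (eq p N≤p)

  recognizable-term : ∀ {n} (t : Term n) → Recognizable (Graph ⟦ t ⟧)
  recognizable-term (var i)  = recognizable-rename (pair zero (suc i)) recognizable-≈
  recognizable-term zeroT    = recognizable-rename {m = 1} (λ _ → zero) (recognizable-eventually λ { (a ∷ []) → a ≡ false })
  recognizable-term oneT     = recognizable-rename {m = 1} (λ _ → zero) (recognizable-eventually λ { (a ∷ []) → a ≡ true })
  recognizable-term (s ∧T t) = recognizable-binaryOp {V = ⟦ s ⟧} {⟦ t ⟧} _∧_ (recognizable-term s) (recognizable-term t)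
  recognizable-term (s ∨T t) = recognizable-binaryOp {V = ⟦ s ⟧} {⟦ t ⟧} _∨_ (recognizable-term s) (recognizable-term t)
  recognizable-term (compT t) = recognizable-unary {V = ⟦ t ⟧} (λ _ → ∁) (λ _ → ∁-cong)
    (recognizable-eventually λ { (a ∷ b ∷ []) → a ≡ not b }) (recognizable-term t)
  recognizable-term (fT t)    = recognizable-unary {V = ⟦ t ⟧} aut aut-cong recognizable-aut (recognizable-term t)
  recognizable-term (finvT t) = recognizable-unary {V = ⟦ t ⟧} autInv autInv-cong
    -- The graph of the inverse is the graph of the automorphism with its two variables exchanged.
    (recognizable-⇔ (λ d ρ → mk⇔ (≈*-autInv d) (≈*-autInv⁻ d)) (recognizable-rename (pair (suc zero) zero) recognizable-aut))
    (recognizable-term t)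

  recognizable-atomic : ∀ {n} (_∼_ : Pω → Pω → Set) →
    (∀ {a b c} → a ≈* b → a ∼ c → b ∼ c) → (∀ {a b c} → b ≈* c → a ∼ b → a ∼ c) →
    Recognizable {2} (λ _ ρ → proj₁ (ρ zero) ∼ proj₁ (ρ (suc zero))) →
    (s t : Term n) → Recognizable (λ d ρ → ⟦ s ⟧ d ρ ∼ ⟦ t ⟧ d ρ)
  recognizable-atomic _∼_ respˡ respʳ R s t = recognizable-subst
    {Q = λ d ρ → proj₁ (ρ zero) ∼ ⟦ t ⟧ d (λ i → ρ (suc i))} (λ _ _ → respˡ)
    (recognizable-subst (λ _ _ → respʳ) (recognizable-rename (pair (suc zero) zero) R)
      (recognizable-weaken {V = ⟦ t ⟧} (recognizable-term t)))
    (recognizable-term s)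

  -- Stated for `Full`, because projection builds witnesses as arbitrary subsets of ω. Other
  -- structures are reached through elementarity.
  recognizable-sat : ∀ {n} (φ : Formula n) → Recognizable (λ d ρ → Sat Full d φ ρ)
  recognizable-sat (s ≐ t) = recognizable-atomic _≈*_ (λ a≈b → ≈*-trans (≈*-sym a≈b)) (λ b≈c a≈b → ≈*-trans a≈b b≈c)
    recognizable-≈ s t
  recognizable-sat (s ≼ t) = recognizable-atomic _≤*_ ≤*-respˡ ≤*-respʳ
    (recognizable-eventually λ { (a ∷ b ∷ []) → a ≡ true → b ≡ true }) s t
  recognizable-sat ⊤F       = recognizable-⇔ (λ _ _ → mk⇔ _ (λ _ → 0 , λ _ _ → tt)) (recognizable-eventually λ _ → ⊤)
  recognizable-sat ⊥F       = recognizable-⇔ (λ _ _ → mk⇔ (λ (N , never) → never N ≤-refl) ⊥-elim) (recognizable-eventually λ _ → ⊥)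
  recognizable-sat (¬F φ)   = recognizable-¬ (recognizable-sat φ)
  recognizable-sat (φ ∧F ψ) = recognizable-binary _×_ _×-⇔_ (recognizable-sat φ) (recognizable-sat ψ)
  recognizable-sat (φ ∨F ψ) = recognizable-binary _⊎_ _⊎-⇔_ (recognizable-sat φ) (recognizable-sat ψ)
  recognizable-sat (φ ⇒F ψ) = recognizable-binary (λ A B → A → B) →-cong-⇔ (recognizable-sat φ) (recognizable-sat ψ)
  recognizable-sat (∀F φ)   = recognizable-⇔
    (λ d ρ → mk⇔ (λ none x → decidable-stable em λ ¬φ → none (x , ¬φ)) (λ all (x , ¬φ) → ¬φ (all x)))
    (recognizable-¬ (recognizable-∃ (recognizable-¬ (recognizable-sat φ))))
  recognizable-sat (∃F φ)   = recognizable-∃ (recognizable-sat φ)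

  -- The existential formula expressing a factorization

  -- A factorization is witnessed by a set δ of block beginnings and a labelling s accumulating the value
  -- of the current block, both in the reading direction; this is a condition on neighbouring positions only.
  module Run {S : Set} (_·_ : S → S → S) (e : S) where

    -- Here `s′` is the label at the position read just before. Where a block begins, `s′` must be
    -- the full value `e` of the block just completed, and accumulation restarts at the letter `x`.
    Step : Bool → S → S → S → Set
    Step true  s x s′ = s ≡ x × s′ ≡ e
    Step false s x s′ = s ≡ s′ · x

    StepAt : Dir → (ℕ → Bool) → (ℕ → S) → (ℕ → S) → ℕ → Set
    StepAt fwd δ s u p = Step (δ (suc p)) (s (suc p)) (u (suc p)) (s p)
    StepAt bwd δ s u p = Step (δ p) (s p) (u p) (s (suc p))

    begins : ∀ {b s x s′} → b ≡ true → Step b s x s′ → s ≡ x × s′ ≡ e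
    begins refl step = step

    module _ (assoc : Associative _≡_ _·_) (ee≡e : e · e ≡ e) {δ : ℕ → Bool} {s u : ℕ → S} where

      private
        -- Compares the product `v` since a fixed block beginning with the label `t`, the product
        -- since the latest one: completed blocks in between contribute a single factor `e` by
        -- idempotency.
        _~_ : S → S → Set
        v ~ t = v ≡ t ⊎ v ≡ e · t

        ~-step : ∀ b {t x t′ v} → Step b t x t′ → v ~ t′ → (v · x) ~ t
        ~-step true  (refl , refl) (inj₁ refl) = inj₂ refl
        ~-step true  (refl , refl) (inj₂ refl) = inj₂ (cong (_· _) ee≡e)
        ~-step false refl          (inj₁ refl) = inj₁ refl
        ~-step false refl          (inj₂ refl) = inj₂ (assoc e _ _)

        ~-end : ∀ {t v} → t ≡ e → v ~ t → v ≡ e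
        ~-end refl (inj₁ eq) = eq
        ~-end refl (inj₂ eq) = trans eq ee≡e

        forward : ∀ {N i} → (∀ p → N ≤ p → StepAt fwd δ s u p) → N < i → δ i ≡ true →
                  ∀ p → i ≤ p → Σ S λ v → Seg _·_ u i (suc p) v × v ~ s p
        forward {i = suc i} steps (s≤s N≤i) δi p i≤p with m≤n⇒m<n∨m≡n i≤p
        ... | inj₂ refl = _ , one , inj₁ (sym (proj₁ (begins δi (steps i N≤i))))
        forward {i = suc i} steps (s≤s N≤i) δi (suc p) _ | inj₁ (s≤s i<p) with forward steps (s≤s N≤i) δi p i<p
        ... | v , x , v~s = _ , snoc x , ~-step (δ (suc p)) (steps p (≤-trans N≤i (<⇒≤ i<p))) v~s

        backward : ∀ {N j} → (∀ p → N ≤ p → StepAt bwd δ s u p) → δ j ≡ true →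
                   ∀ k p → k + p ≡ j → N ≤ p → Σ S λ v → Seg (flip _·_) u p (suc j) v × v ~ s p
        backward steps δj zero p refl N≤p = _ , one , inj₁ (sym (proj₁ (begins δj (steps p N≤p))))
        backward steps δj (suc k) p eq N≤p with backward steps δj k (suc p) (trans (+-suc k p) eq) (m≤n⇒m≤1+n N≤p)
        ... | v , x , v~s = _ , Seg-++ (λ a b c → sym (assoc c b a)) one x , ~-step (δ p) (steps p N≤p) v~s

      run⇒factorization : ∀ d → ¬ (δ ≈* 𝟎) → Eventually (StepAt d δ s u) → Factorization (directed d _·_) u e
      -- Cuts are sought beyond `N`, since the condition on a position `i` is the step at its
      -- predecessor.
      run⇒factorization fwd δ≉𝟎 (N , steps) with enumerate (λ p → δ p ≡ true) (infinitely-often δ≉𝟎) (suc N)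
      ... | g , inc , N<g0 , δg = g , λ {m} {n} m<n → segment (g m) (g n) (N<g m) (δg m) (δg n) (increasing-< inc m<n)
        where
        N<g : ∀ n → N < g n
        N<g n = ≤-trans N<g0 (increasing-≤ inc z≤n)
        segment : ∀ i j → N < i → δ i ≡ true → δ j ≡ true → i < j → Seg _·_ u i j e
        segment i (suc q) N<i δi δj (s≤s i≤q) with forward steps N<i δi q i≤q
        ... | v , x , v~s = subst (Seg _·_ u i (suc q))
          (~-end (proj₂ (begins δj (steps q (≤-trans (<⇒≤ N<i) i≤q)))) v~s) x
      run⇒factorization bwd δ≉𝟎 (N , steps) with enumerate (λ p → δ p ≡ true) (infinitely-often δ≉𝟎) N
      -- Read from right to left, a block begins at its largest position, so the half-open interval
      -- ends one further.
      ... | g , inc , N≤g0 , δg = suc ∘ g , λ {m} {n} m<n → segment (N≤g m) (δg m) (δg n) (increasing-< inc m<n)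
        where
        N≤g : ∀ n → N ≤ g n
        N≤g n = ≤-trans N≤g0 (increasing-≤ inc z≤n)
        segment : ∀ {i j} → N ≤ i → δ i ≡ true → δ j ≡ true → i < j → Seg (flip _·_) u (suc i) (suc j) e
        segment {i} {j} N≤i δi δj i<j with backward steps δj (j ∸ suc i) (suc i) (m∸n+n≡m i<j) (m≤n⇒m≤1+n N≤i)
        ... | v , x , v~s = subst (Seg (flip _·_) u (suc i) (suc j))
          (~-end (proj₂ (begins δi (steps i N≤i))) v~s) x

    module Labelling {u : ℕ → S} (d : Dir) (f : Factorization (directed d _·_) u e) where

      cuts : ℕ → ℕ
      cuts = proj₁ f

      segs : ∀ {m n} → m < n → Seg (directed d _·_) u (cuts m) (cuts n) e
      segs = proj₂ f

      cuts-inc : StrictlyIncreasing cuts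
      cuts-inc = cuts-increasing segs

      IsCut : ℕ → Set
      IsCut p = Σ ℕ λ n → p ≡ cuts n

      -- What has been read of block `n` on reaching `p`, in the direction of reading; its value is
      -- the label.
      Part : Dir → ℕ → ℕ → S → Set
      Part fwd n p v = Seg (directed d _·_) u (cuts n) (suc p) v
      Part bwd n p v = Seg (directed d _·_) u p (cuts (suc n)) v

      part-exists : ∀ d′ {n p} → InBlock cuts p n → Σ S (Part d′ n p)
      part-exists fwd (gn≤p , _) = Seg-total _ u (s≤s gn≤p)
      part-exists bwd (_ , p<gn⁺) = Seg-total _ u p<gn⁺

      State : ℕ → S → Set
      State p v = Σ ℕ λ n → InBlock cuts p n × Part d n p v

      label : ℕ → S
      -- The default concerns only positions before the first cut, where no step condition is
      -- claimed.
      label = choose State u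

      label-part : ∀ {n p} → InBlock cuts p n → Part d n p (label p)
      label-part {n} {p} inBlock with choose-spec State u (n , inBlock , proj₂ (part-exists d inBlock))
      ... | n′ , inBlock′ , x with block-unique cuts-inc inBlock′ inBlock
      ...   | refl = x

      data Position (n p : ℕ) : Set where
        inside : InBlock cuts (suc p) n → decide (IsCut (suc p)) ≡ false → Position n p
        atEnd  : suc p ≡ cuts (suc n) → InBlock cuts (suc p) (suc n) → decide (IsCut (suc p)) ≡ true → Position n p

      position : ∀ {n p} → InBlock cuts p n → Position n p
      position {n} {p} (gn≤p , p<gn⁺) with m≤n⇒m<n∨m≡n p<gn⁺
      ... | inj₂ eq = atEnd eq (≤-reflexive (sym eq) , subst (_< cuts (suc (suc n))) (sym eq) (cuts-inc (suc n)))
                        (from decide-⇔ (suc n , eq))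
      ... | inj₁ 1+p<gn⁺ = inside (m≤n⇒m≤1+n gn≤p , 1+p<gn⁺) (¬-not λ eq → noCut (to decide-⇔ eq))
        where
        noCut : IsCut (suc p) → ⊥
        noCut (m , eq) with block-unique cuts-inc (≤-reflexive (sym eq) , subst (_< cuts (suc m)) (sym eq) (cuts-inc m))
                                                  (m≤n⇒m≤1+n gn≤p , 1+p<gn⁺)
        ... | refl = n≮n p (subst (_≤ p) (sym eq) gn≤p)

      cuts-infinite : ¬ ((λ p → decide (IsCut (suc p))) ≈* 𝟎)
      cuts-infinite (N , never) with cuts (suc N) in eq | n≤increasing cuts-inc (suc N)
      ... | suc q | s≤s N≤q = contradiction (trans (sym (never q N≤q)) (from decide-⇔ (suc N , sym eq))) λ ()

    factorization⇒run : ∀ d {u} → Associative _≡_ _·_ → Factorization (directed d _·_) u e →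
      Σ (ℕ → Bool) λ δ → Σ (ℕ → S) λ s → ¬ (δ ≈* 𝟎) × Eventually (StepAt d δ s u)
    factorization⇒run fwd {u} _ f = δ , label , δ-infinite , cuts 0 , λ p g0≤p → step (proj₂ (block-exists cuts-inc g0≤p))
      where
      open Labelling fwd f
      δ : ℕ → Bool
      δ p = decide (IsCut p)
      δ-infinite : ¬ (δ ≈* 𝟎)
      δ-infinite (N , never) = cuts-infinite (N , λ p N≤p → never (suc p) (m≤n⇒m≤1+n N≤p))
      step : ∀ {n p} → InBlock cuts p n → StepAt fwd δ label u p
      step {n} {p} here with position here
      ... | inside there notCut rewrite notCut = Seg-unique (label-part there) (snoc (label-part here))
      ... | atEnd end there isCut rewrite isCut =
        Seg-unique (subst (λ i → Seg _·_ u i (suc (suc p)) (label (suc p))) (sym end) (label-part there)) one ,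
        Seg-unique (label-part here) (subst (λ j → Seg _·_ u (cuts n) j e) (sym end) (segs ≤-refl))
    factorization⇒run bwd {u} assoc f = δ , label , cuts-infinite , cuts 0 , λ p g0≤p → step (proj₂ (block-exists cuts-inc g0≤p))
      where
      open Labelling bwd f
      δ : ℕ → Bool
      -- The position just below a cut is where a block begins when reading leftwards.
      δ p = decide (IsCut (suc p))
      step : ∀ {n p} → InBlock cuts p n → StepAt bwd δ label u p
      step {n} {p} here with position here
      ... | inside there notCut rewrite notCut =
        Seg-unique (label-part here) (Seg-++ (λ a b c → sym (assoc c b a)) one (label-part there))
      ... | atEnd end there isCut rewrite isCut =
        Seg-unique (subst (λ j → Seg (flip _·_) u p j (label p)) (sym end) (label-part here)) one ,
        Seg-unique (label-part there) (subst (λ i → Seg (flip _·_) u i (cuts (suc (suc n))) e) (sym end) (segs ≤-refl))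

  -- Shannon expansion: a Boolean term that selects one of its branches by the bits of `ts`, so any
  -- finite table becomes a term.
  caseTerm : ∀ k {n} → (Fin k → Term n) → (Vec Bool k → Term n) → Term n
  caseTerm zero    ts c = c []
  caseTerm (suc k) ts c = (ts zero ∧T caseTerm k (ts ∘ suc) (c ∘ (true ∷_)))
                       ∨T (compT (ts zero) ∧T caseTerm k (ts ∘ suc) (c ∘ (false ∷_)))

  eval-caseTerm : ∀ k {n} d (ζ : Fin n → Pω) ts c p →
    evalT d ζ (caseTerm k ts c) p ≡ evalT d ζ (c (tabulate λ i → evalT d ζ (ts i) p)) p
  eval-caseTerm zero    d ζ ts c p = refl
  eval-caseTerm (suc k) d ζ ts c p with evalT d ζ (ts zero) p
  ... | true  = trans (∨-identityʳ _) (eval-caseTerm k d ζ (ts ∘ suc) (c ∘ (true ∷_)) p)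
  ... | false = eval-caseTerm k d ζ (ts ∘ suc) (c ∘ (false ∷_)) p

  boolTerm : ∀ {n} → Bool → Term n
  boolTerm true  = oneT
  boolTerm false = zeroT

  eval-boolTerm : ∀ b {n} d (ζ : Fin n → Pω) p → evalT d ζ (boolTerm b) p ≡ b
  eval-boolTerm true  d ζ p = refl
  eval-boolTerm false d ζ p = refl

  ∃F* : ∀ m {n} → Formula (m + n) → Formula n
  ∃F* zero    φ = φ
  ∃F* (suc m) φ = ∃F* m (∃F φ)

  extend* : ∀ {X : Set} m {n} → (Fin m → X) → (Fin n → X) → Fin (m + n) → X
  extend* zero    ξ ρ = ρ
  extend* (suc m) ξ ρ = extend (ξ zero) (extend* m (ξ ∘ suc) ρ)

  extend*-↑ˡ : ∀ {X : Set} {m n} (ξ : Fin m → X) (ρ : Fin n → X) i → extend* m ξ ρ (i ↑ˡ n) ≡ ξ i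
  extend*-↑ˡ ξ ρ zero    = refl
  extend*-↑ˡ ξ ρ (suc i) = extend*-↑ˡ (ξ ∘ suc) ρ i

  extend*-↑ʳ : ∀ {X : Set} m {n} (ξ : Fin m → X) (ρ : Fin n → X) i → extend* m ξ ρ (m ↑ʳ i) ≡ ρ i
  extend*-↑ʳ zero    ξ ρ i = refl
  extend*-↑ʳ (suc m) ξ ρ i = extend*-↑ʳ m (ξ ∘ suc) ρ i

  sat-∃F* : ∀ {D d} m {n} (φ : Formula (m + n)) {ρ : Fin n → Elem D} →
    Sat D d (∃F* m φ) ρ ⇔ Σ (Fin m → Elem D) λ ξ → Sat D d φ (extend* m ξ ρ)
  sat-∃F* zero    φ = mk⇔ ((λ ()) ,_) proj₂
  sat-∃F* (suc m) φ = mk⇔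
    (λ sat → let (ξ , x , sat′) = to (sat-∃F* m (∃F φ)) sat in extend x ξ , sat′)
    (λ (ξ , sat) → from (sat-∃F* m (∃F φ)) (ξ ∘ suc , ξ zero , sat))

  module RunFormula {S : Set} (fin : Finite S) (_·_ : S → S → S) (assoc : Associative _≡_ _·_)
                    (e : S) {n} (value : Vec Bool n → S) where
    open Finite fin
    open Run _·_ e

    -- One set variable for the block beginnings and `bits` further ones for the code of the label.
    hidden : ℕ
    hidden = suc bits

    StepBits : Vec Bool hidden → Vec Bool n → Vec Bool hidden → Set
    StepBits x a x′ = Step (head x) (dec (tail x)) (value a) (dec (tail x′))

    resultTerm : Vec Bool hidden → Vec Bool n → Vec Bool hidden → Term (hidden + n)
    resultTerm x a x′ = boolTerm (decide (StepBits x a x′))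

    -- The function symbol fetches the bit at the position read before: `p - 1` under σ, `p + 1`
    -- under σ⁻¹. Hence one formula serves both structures.
    previousTerm : Vec Bool hidden → Vec Bool n → Term (hidden + n)
    previousTerm x a = caseTerm hidden (λ i → fT (var (i ↑ˡ n))) (resultTerm x a)

    letterTerm : Vec Bool hidden → Term (hidden + n)
    letterTerm x = caseTerm n (λ i → var (hidden ↑ʳ i)) (previousTerm x)

    stepTerm : Term (hidden + n)
    stepTerm = caseTerm hidden (λ i → var (i ↑ˡ n)) letterTerm

    -- Quantifier-free: an equation says that the steps are correct almost everywhere, a negated
    -- equation that infinitely many blocks begin. Embeddings preserve and reflect equations, hence
    -- preserve both conjuncts.
    matrix : Formula (hidden + n)
    matrix = (stepTerm ≐ oneT) ∧F (¬F (var zero ≐ zeroT))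

    module _ (d : Dir) (ζ : Fin (hidden + n) → Pω) where

      current previous : ℕ → Vec Bool hidden
      current p  = tabulate λ i → ζ (i ↑ˡ n) p
      previous p = tabulate λ i → aut d (ζ (i ↑ˡ n)) p

      read : ℕ → Vec Bool n
      read p = tabulate λ i → ζ (hidden ↑ʳ i) p

      HoldsAt : ℕ → Set
      HoldsAt p = StepBits (current p) (read p) (previous p)

      eval-stepTerm : ∀ p → evalT d ζ stepTerm p ≡ decide (HoldsAt p)
      eval-stepTerm p =
        trans (eval-caseTerm hidden d ζ (λ i → var (i ↑ˡ n)) letterTerm p)
          (trans (eval-caseTerm n d ζ (λ i → var (hidden ↑ʳ i)) (previousTerm (current p)) p)
            (trans (eval-caseTerm hidden d ζ (λ i → fT (var (i ↑ˡ n))) (resultTerm (current p) (read p)) p)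
              (eval-boolTerm _ d ζ p)))

      stepTerm-⇔ : evalT d ζ stepTerm ≈* 𝟏 ⇔ Eventually HoldsAt
      stepTerm-⇔ = mk⇔
        (λ (N , eq) → N , λ p N≤p → to decide-⇔ (trans (sym (eval-stepTerm p)) (eq p N≤p)))
        (λ (N , holds) → N , λ p N≤p → trans (eval-stepTerm p) (from decide-⇔ (holds p N≤p)))

    StepsBits : Dir → (ℕ → Vec Bool hidden) → (ℕ → Vec Bool n) → ℕ → Set
    StepsBits d x w = StepAt d (head ∘ x) (dec ∘ tail ∘ x) (value ∘ w)

    eventually-holds-⇔ : ∀ d ζ → Eventually (HoldsAt d ζ) ⇔
      Eventually (StepsBits d (λ p → tabulate λ i → ζ (i ↑ˡ n) p) (λ p → tabulate λ i → ζ (hidden ↑ʳ i) p))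
    eventually-holds-⇔ fwd ζ = mk⇔
      (λ (N , holds) → N , λ p N≤p → holds (suc p) (m≤n⇒m≤1+n N≤p))
      -- Position 0 has no predecessor; raising the threshold by one avoids it.
      (λ (N , steps) → suc N , λ { (suc p) (s≤s N≤p) → steps p N≤p })
    eventually-holds-⇔ bwd ζ = mk⇔ id id

    -- Any `D` is allowed because the matrix has no quantifiers; in particular the witnesses may be
    -- images under an embedding.
    matrix-sound : ∀ {D d} (ζ : Fin (hidden + n) → Elem D) → e · e ≡ e → Sat D d matrix ζ →
      Factorization (directed d _·_) (λ p → value (tabulate λ i → proj₁ (ζ (hidden ↑ʳ i)) p)) e
    matrix-sound {d = d} ζ ee≡e (steps , infinite) =
      run⇒factorization assoc ee≡e d infinite
        (to (eventually-holds-⇔ d (λ i → proj₁ (ζ i))) (to (stepTerm-⇔ d (λ i → proj₁ (ζ i))) steps))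

    matrix-complete : ∀ d (ρ : Env n) → Factorization (directed d _·_) (λ p → value (letter ρ p)) e →
      Sat Full d (∃F* hidden matrix) ρ
    matrix-complete d ρ f with factorization⇒run d assoc f
    ... | δ , s , infinite , N , steps = from (sat-∃F* hidden matrix)
      (ξ , from (stepTerm-⇔ d ζ) (from (eventually-holds-⇔ d ζ) (N , λ p N≤p → at d p (steps p N≤p))) , infinite)
      where
      ξ : Fin hidden → Elem Full
      ξ zero    = δ , tt
      ξ (suc i) = (λ p → lookup (enc (s p)) i) , tt
      ζ : Fin (hidden + n) → Pω
      ζ i = proj₁ (extend* hidden ξ ρ i)
      label-correct : ∀ p → dec (tabulate λ i → ζ (suc i ↑ˡ n) p) ≡ s p
      label-correct p = trans
        (cong dec (trans (tabulate-cong λ i → cong (λ x → proj₁ x p) (extend*-↑ˡ ξ ρ (suc i))) (tabulate∘lookup _)))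
        (dec-enc (s p))
      letter-correct : ∀ p → value (tabulate λ i → ζ (hidden ↑ʳ i) p) ≡ value (letter ρ p)
      letter-correct p = cong value (tabulate-cong λ i → cong (λ x → proj₁ x p) (extend*-↑ʳ hidden ξ ρ i))
      at : ∀ d p → StepAt d δ s (value ∘ letter ρ) p →
           StepsBits d (λ p → tabulate λ i → ζ (i ↑ˡ n) p) (λ p → tabulate λ i → ζ (hidden ↑ʳ i) p) p
      at fwd p step rewrite label-correct (suc p) | letter-correct (suc p) | label-correct p = step
      at bwd p step rewrite label-correct (suc p) | letter-correct p | label-correct p = step

  -- Transfer of formulas along an embedding

  module Transfer {A B : Pω → Set} {d₁ d₂ : Dir} (subA : IsSubstructure A)
                  (η : Elem A → Elem B) (emb : IsEmbedding A d₁ B d₂ η) where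
    open IsSubstructure subA
    open IsEmbedding emb

    closed-aut : ∀ d {a} → A a → A (aut d a)
    closed-aut fwd = cloσ
    closed-aut bwd = cloσ⁻¹

    closed-autInv : ∀ d {a} → A a → A (autInv d a)
    closed-autInv fwd = cloσ⁻¹
    closed-autInv bwd = cloσ

    module _ {n} (ζ : Fin n → Elem A) where

      closed : ∀ t → A (evalT d₁ (λ i → proj₁ (ζ i)) t)
      closed (var i)   = proj₂ (ζ i)
      closed zeroT     = has𝟎
      closed oneT      = has𝟏
      closed (s ∧T t)  = clo⊓ (closed s) (closed t)
      closed (s ∨T t)  = clo⊔ (closed s) (closed t)
      closed (compT t) = clo∁ (closed t)
      closed (fT t)    = closed-aut d₁ (closed t)
      closed (finvT t) = closed-autInv d₁ (closed t)

      elem : Term n → Elem A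
      elem t = _ , closed t

      η-term : ∀ t → proj₁ (η (elem t)) ≈* evalT d₂ (λ i → proj₁ (η (ζ i))) t
      η-term (var i)   = ≈*-refl
      η-term zeroT     = pres𝟎 (elem zeroT) ≈*-refl
      η-term oneT      = pres𝟏 (elem oneT) ≈*-refl
      η-term (s ∧T t)  = ≈*-trans (pres⊓ (elem s) (elem t) (elem (s ∧T t)) ≈*-refl) (⊓-cong (η-term s) (η-term t))
      η-term (s ∨T t)  = ≈*-trans (pres⊔ (elem s) (elem t) (elem (s ∨T t)) ≈*-refl) (⊔-cong (η-term s) (η-term t))
      η-term (compT t) = ≈*-trans (pres∁ (elem t) (elem (compT t)) ≈*-refl) (∁-cong (η-term t))
      η-term (fT t)    = ≈*-trans (commute (elem t) (elem (fT t)) ≈*-refl) (aut-cong d₂ (η-term t))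
      -- `commute` speaks of the automorphism alone, so it is applied to `finvT t`, which the
      -- automorphism sends to `t`, and the result is inverted in the target.
      η-term (finvT t) = ≈*-trans
        (≈*-autInv d₂ (commute (elem (finvT t)) (elem t) (≈*-sym (aut-autInv d₁ _))))
        (autInv-cong d₂ (η-term t))

      preserves-≐ : ∀ s t → Sat A d₁ (s ≐ t) ζ → Sat B d₂ (s ≐ t) (η ∘ ζ)
      preserves-≐ s t eq = ≈*-trans (≈*-sym (η-term s)) (≈*-trans (wellDefined (elem s) (elem t) eq) (η-term t))

      reflects-≐ : ∀ s t → Sat B d₂ (s ≐ t) (η ∘ ζ) → Sat A d₁ (s ≐ t) ζ
      reflects-≐ s t eq = injective (elem s) (elem t) (≈*-trans (η-term s) (≈*-trans eq (≈*-sym (η-term t))))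

  open IsElementarySubstructure

  -- The parameters have a factorization with some accepted value `c`. Elementarity of `A` puts
  -- witnesses for it inside `A`, where `η` applies; their images satisfy the matrix, so the image
  -- word also has value `c`. Acceptance of `c` gives `φ` in the full target structure, and
  -- elementarity of `B` brings it down.
  embedding-preserves : ∀ {A B d₁ d₂} → IsElementarySubstructure A d₁ → IsElementarySubstructure B d₂ →
    (η : Elem A → Elem B) → IsEmbedding A d₁ B d₂ η →
    ∀ {n} (φ : Formula n) (ρ : Fin n → Elem A) → Sat A d₁ φ ρ → Sat B d₂ φ (η ∘ ρ)
  embedding-preserves {A} {B} {d₁} {d₂} elA elB η emb {n} φ ρ sat =
    from (elementary elB φ (η ∘ ρ)) (to (R.correct d₂ _ transferred) accepted)
    where
    open Transfer (isSub elA) η emb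
    module R = Recognizable (recognizable-sat φ)

    ρ̄ : Env n
    ρ̄ i = proj₁ (ρ i) , tt

    ramsey-value = factorization-exists R.finite (directed d₁ R.op) (λ p → R.value (letter ρ̄ p))

    c : R.Carrier
    c = proj₁ ramsey-value

    accepted : R.Accept c
    accepted = from (R.correct d₁ ρ̄ (proj₂ ramsey-value)) (to (elementary elA φ ρ) sat)

    cc≡c : R.op c c ≡ c
    cc≡c = trans (sym (directed-square d₁)) (factorization-idempotent (directed-assoc d₁ R.assoc) (proj₂ ramsey-value))

    open RunFormula R.finite R.op R.assoc c R.value

    run : Σ (Fin hidden → Elem A) λ ξ → Sat A d₁ matrix (extend* hidden ξ ρ)
    run = to (sat-∃F* hidden matrix)
      (from (elementary elA (∃F* hidden matrix) ρ) (matrix-complete d₁ ρ̄ (proj₂ ramsey-value)))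

    ζ : Fin (hidden + n) → Elem A
    ζ = extend* hidden (proj₁ run) ρ

    transferred : Factorization (directed d₂ R.op) (λ p → R.value (letter (λ i → proj₁ (η (ρ i)) , tt) p)) c
    transferred = factorization-map id (λ _ _ → refl)
      (λ p → cong R.value (tabulate-cong λ i → cong (λ x → proj₁ (η x) p) (sym (extend*-↑ʳ hidden (proj₁ run) ρ i))))
      (matrix-sound (η ∘ ζ) cc≡c
        (preserves-≐ ζ stepTerm oneT (proj₁ (proj₂ run)) ,
         proj₂ (proj₂ run) ∘ reflects-≐ ζ (var zero) zeroT))

  embedding-elementary : ∀ {A B d₁ d₂} → IsElementarySubstructure A d₁ → IsElementarySubstructure B d₂ →
    (η : Elem A → Elem B) → IsEmbedding A d₁ B d₂ η → IsElementary A d₁ B d₂ η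
  embedding-elementary elA elB η emb φ ρ = mk⇔
    (embedding-preserves elA elB η emb φ ρ)
    -- Reflection of `φ` is preservation of its negation.
    (λ satB → decidable-stable em λ ¬satA → embedding-preserves elA elB η emb (¬F φ) ρ ¬satA satB)

full-elementary : ∀ d → IsElementarySubstructure Full d
full-elementary d = record { isSub = _ ; elementary = λ φ ρ → mk⇔ id id }

theorem12p6 : ExcludedMiddle 0ℓ →
    ((A B : Pω → Set) →
    IsElementarySubstructure A fwd → IsElementarySubstructure B fwd →
    (η : Elem A → Elem B) → IsEmbedding A fwd B fwd η →
    IsElementary A fwd B fwd η)
    × ((A : Pω → Set) →
    IsElementarySubstructure A fwd →
    (η : Elem A → Elem Full) → IsEmbedding A fwd Full bwd η →
    IsElementary A fwd Full bwd η)
    × ((C : Pω → Set) →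
    IsElementarySubstructure C bwd →
    (η : Elem C → Elem Full) → IsEmbedding C bwd Full fwd η →
    IsElementary C bwd Full fwd η)
theorem12p6 em =
  (λ A B elA elB → embedding-elementary elA elB) ,
  (λ A elA → embedding-elementary elA (full-elementary bwd)) ,
  (λ C elC → embedding-elementary elC (full-elementary fwd))
  where open Classical em
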